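{- Let $\mathcal{C}$ be a permutation class. If $\mathcal{C}$ is well-quasi-ordered (wqo) under the containment order, then its sum closure $\bigoplus\mathcal{C}$ and its skew closure $\mathop{\ominus}\mathcal{C}$ are also wqo. Likewise, if $\mathcal{C}$ is labelled well-quasi-ordered (lwqo), then $\bigoplus\mathcal{C}$ and $\mathop{\ominus}\mathcal{C}$ are also lwqo. (Here the prefix operator $\mathop{\ominus}$ denotes the skew-sum analogue of $\bigoplus$.)
   Context: A permutation of length $n$ is an arrangement $\pi=\pi(1)\cdots\pi(n)$ of $1,\dots,n$ (the empty permutation is allowed). The permutation $\sigma$ of length $k$ is contained in $\pi$ of length $n$, written $\sigma\le\pi$, if there are indices $1\le i_1<\cdots<i_k\le n$ such that $\pi(i_1)\cdots\pi(i_k)$ is order isomorphic to $\sigma$. A permutation class is a set of permutations closed downward under containment (so a nonempty class contains the empty permutation). For permutations $\sigma$ of length $m$ and $\tau$ of length $n$, the sum $\sigma\oplus\tau$ has length $m+n$ and is given by $(\sigma\oplus\tau)(i)=\sigma(i)$ for $1\le i\le m$ and $\tau(i-m)+m$ for $m+1\le i\le m+n$; the skew sum $\sigma\ominus\tau$ is given by $(\sigma\ominus\tau)(i)=\sigma(i)+n$ for $1\le i\le m$ and $\tau(i-m)$ for $m+1\le i\le m+n$. The sum closure $\bigoplus\mathcal{C}$ is the smallest permutation class containing $\mathcal{C}$ and closed under $\oplus$; equivalently $\bigoplus\mathcal{C}=\{\alpha_1\oplus\cdots\oplus\alpha_m : \alpha_1,\dots,\alpha_m\in\mathcal{C}\}$.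 The skew closure $\mathop{\ominus}\mathcal{C}$ is defined in the same way with the binary operation $\ominus$ in place of $\oplus$. A quasi-order $(Y,\le)$ is wqo if every infinite sequence $y_1,y_2,\dots$ in $Y$ has indices $i<j$ with $y_i\le y_j$. Given a quasi-order $(L,\le_L)$, an $L$-labelled permutation is a pair $(\pi,\ell_\pi)$ with $\pi$ a permutation of length $n$ and $\ell_\pi:\{1,\dots,n\}\to L$. We say $(\sigma,\ell_\sigma)\le(\pi,\ell_\pi)$, where $\sigma$ and $\pi$ have lengths $k$ and $n$, if there are indices $1\le i_1<\cdots<i_k\le n$ such that $\pi(i_1)\cdots\pi(i_k)$ is order isomorphic to $\sigma$ and $\ell_\sigma(j)\le_L\ell_\pi(i_j)$ for all $1\le j\le k$. For a set $X$ of permutations, $X\wr L$ is the set of all $L$-labelled members of $X$ under this order. The set $X$ is lwqo if $X\wr L$ is wqo for every wqo $(L,\le_L)$. -}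

module Defs where

open import Data.Fin.Base using (Fin; toℕ; _↑ˡ_; _↑ʳ_; _<_)
open import Data.Fin.Permutation
  using (Permutation′; _⟨$⟩ʳ_; cast-id)
open import Data.Fin.Properties
  using (+↔⊎; splitAt-↑ˡ; splitAt-↑ʳ; toℕ-cast; toℕ-↑ˡ; toℕ-↑ʳ)
import Data.Nat.Base as ℕ
open import Data.Nat.Base using (ℕ)
open import Data.Nat.Properties using (+-comm)
open import Data.Product.Base
  using (Σ; ∃; ∃₂; Σ-syntax; _×_; _,_; proj₁; proj₂)
open import Data.Sum.Function.Propositional using (_⊎-↔_)
open import Data.Sum.Properties using (swap-↔)
open import Function.Base using (_∘_; id)
open import Function.Bundles using (_⇔_)
open import Function.Construct.Composition using (_↔-∘_; _⇔-∘_)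
open import Function.Construct.Identity using (⇔-id)
open import Function.Construct.Symmetry using (↔-sym)
open import Level using (Level; 0ℓ; _⊔_) renaming (suc to lsuc)
open import Relation.Binary.Bundles using (Preorder)
import Relation.Binary.Construct.On as On
open import Relation.Binary.PropositionalEquality
  using (_≡_; refl; trans; isEquivalence)
open import Relation.Unary using (Pred; _⊆_)

private
  variable
    p q c ℓ₁ ℓ₂ : Level
    m n : ℕ

-- Positions and values are 0-based.
Perm : Set
Perm = Σ ℕ Permutation′

length : Perm → ℕ
length = proj₁

infix 9 _at_
_at_ : (π : Perm) → Fin (length π) → Fin (length π)
π at i = proj₂ π ⟨$⟩ʳ i

infix 4 _≼_
record _≼_ (σ π : Perm) : Set where
  field
    index      : Fin (length σ) → Fin (length π)
    increasing : ∀ {i j} → i < j → index i < index j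
    orderIso   : ∀ i j → (σ at i < σ at j) ⇔ (π at index i < π at index j)

open _≼_ public

≼-refl : ∀ {π} → π ≼ π
≼-refl = record { index = id ; increasing = id ; orderIso = λ _ _ → ⇔-id _ }

≼-trans : ∀ {ρ σ π} → ρ ≼ σ → σ ≼ π → ρ ≼ π
≼-trans f g = record
  { index      = index g ∘ index f
  ; increasing = increasing g ∘ increasing f
  ; orderIso   = λ i j → orderIso g (index f i) (index f j) ⇔-∘ orderIso f i j
  }

≼-preorder : Preorder 0ℓ 0ℓ 0ℓ
≼-preorder = record
  { Carrier    = Perm
  ; _≈_        = _≡_
  ; _≲_        = _≼_
  ; isPreorder = record
    { isEquivalence = isEquivalence
    ; reflexive     = λ { refl → ≼-refl }
    ; trans         = ≼-trans
    }
  }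

-- Two pairs (n , π), (n , π′) with pointwise equal π and π′ need not be
-- propositionally equal, but each contains the other, so a class never
-- separates them.
IsPermutationClass : Pred Perm p → Set p
IsPermutationClass C = ∀ {σ π} → σ ≼ π → C π → C σ

⊕-perm : Permutation′ m → Permutation′ n → Permutation′ (m ℕ.+ n)
⊕-perm σ τ = ↔-sym +↔⊎ ↔-∘ ((σ ⊎-↔ τ) ↔-∘ +↔⊎)

-- τ takes the n smallest values, so the two blocks of values are swapped
-- before being rejoined.
⊖-perm : Permutation′ m → Permutation′ n → Permutation′ (m ℕ.+ n)
⊖-perm {m} {n} σ τ =
  cast-id (+-comm n m) ↔-∘ (↔-sym +↔⊎ ↔-∘ (swap-↔ ↔-∘ ((σ ⊎-↔ τ) ↔-∘ +↔⊎)))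

infixr 6 _⊕_ _⊖_

_⊕_ : Perm → Perm → Perm
(m , σ) ⊕ (n , τ) = m ℕ.+ n , ⊕-perm σ τ

_⊖_ : Perm → Perm → Perm
(m , σ) ⊖ (n , τ) = m ℕ.+ n , ⊖-perm σ τ

⊕-left : (σ : Permutation′ m) (τ : Permutation′ n) (i : Fin m) →
         toℕ (⊕-perm σ τ ⟨$⟩ʳ (i ↑ˡ n)) ≡ toℕ (σ ⟨$⟩ʳ i)
⊕-left {m} {n} σ τ i rewrite splitAt-↑ˡ m i n = toℕ-↑ˡ (σ ⟨$⟩ʳ i) n

⊕-right : (σ : Permutation′ m) (τ : Permutation′ n) (i : Fin n) →
          toℕ (⊕-perm σ τ ⟨$⟩ʳ (m ↑ʳ i)) ≡ m ℕ.+ toℕ (τ ⟨$⟩ʳ i)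
⊕-right {m} {n} σ τ i rewrite splitAt-↑ʳ m n i = toℕ-↑ʳ m (τ ⟨$⟩ʳ i)

⊖-left : (σ : Permutation′ m) (τ : Permutation′ n) (i : Fin m) →
         toℕ (⊖-perm σ τ ⟨$⟩ʳ (i ↑ˡ n)) ≡ n ℕ.+ toℕ (σ ⟨$⟩ʳ i)
⊖-left {m} {n} σ τ i rewrite splitAt-↑ˡ m i n =
  trans (toℕ-cast (+-comm n m) (n ↑ʳ (σ ⟨$⟩ʳ i))) (toℕ-↑ʳ n (σ ⟨$⟩ʳ i))

⊖-right : (σ : Permutation′ m) (τ : Permutation′ n) (i : Fin n) →
          toℕ (⊖-perm σ τ ⟨$⟩ʳ (m ↑ʳ i)) ≡ toℕ (τ ⟨$⟩ʳ i)
⊖-right {m} {n} σ τ i rewrite splitAt-↑ʳ m n i =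
  trans (toℕ-cast (+-comm n m) ((τ ⟨$⟩ʳ i) ↑ˡ m)) (toℕ-↑ˡ (τ ⟨$⟩ʳ i) m)

data ClosureUnder (_∙_ : Perm → Perm → Perm) (C : Pred Perm p) : Pred Perm p where
  base : ∀ {π} → C π → ClosureUnder _∙_ C π
  op   : ∀ {σ τ} → ClosureUnder _∙_ C σ → ClosureUnder _∙_ C τ →
         ClosureUnder _∙_ C (σ ∙ τ)
  down : ∀ {σ π} → σ ≼ π → ClosureUnder _∙_ C π → ClosureUnder _∙_ C σ

-- By construction the closure is a permutation class that contains C and
-- is closed under _∙_; it is the smallest such class.
ClosureUnder-least :
  ∀ {_∙_} {C : Pred Perm p} (D : Pred Perm q) → IsPermutationClass D →
  (∀ {σ τ} → D σ → D τ → D (σ ∙ τ)) → C ⊆ D → ClosureUnder _∙_ C ⊆ D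
ClosureUnder-least D cl D-op C⊆D (base x)   = C⊆D x
ClosureUnder-least D cl D-op C⊆D (op x y)   =
  D-op (ClosureUnder-least D cl D-op C⊆D x) (ClosureUnder-least D cl D-op C⊆D y)
ClosureUnder-least D cl D-op C⊆D (down s x) =
  cl s (ClosureUnder-least D cl D-op C⊆D x)

SumClosure : Pred Perm p → Pred Perm p
SumClosure = ClosureUnder _⊕_

SkewClosure : Pred Perm p → Pred Perm p
SkewClosure = ClosureUnder _⊖_

LabelledPerm : Preorder c ℓ₁ ℓ₂ → Set c
LabelledPerm L = Σ[ π ∈ Perm ] (Fin (length π) → Preorder.Carrier L)

module _ (L : Preorder c ℓ₁ ℓ₂) where
  private module L = Preorder L

  LabelledContainment : LabelledPerm L → LabelledPerm L → Set ℓ₂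
  LabelledContainment (σ , ℓσ) (π , ℓπ) =
    Σ[ e ∈ σ ≼ π ] (∀ j → ℓσ j L.≲ ℓπ (index e j))

  labelled-preorder : Preorder c c ℓ₂
  labelled-preorder = record
    { Carrier    = LabelledPerm L
    ; _≈_        = _≡_
    ; _≲_        = LabelledContainment
    ; isPreorder = record
      { isEquivalence = isEquivalence
      ; reflexive     = λ { refl → ≼-refl , λ _ → L.refl }
      ; trans         = λ { (f , ℓf) (g , ℓg) →
          ≼-trans f g , λ j → L.trans (ℓf j) (ℓg (index f j)) }
      }
    }

WQO : Preorder c ℓ₁ ℓ₂ → Set (c ⊔ ℓ₂)
WQO Y = (y : ℕ → Carrier) → ∃₂ λ i j → (i ℕ.< j) × (y i ≲ y j)
  where open Preorder Y

containment : Pred Perm p → Preorder p 0ℓ 0ℓ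
containment X = On.preorder {B = ∃ X} ≼-preorder proj₁

infix 8 _≀_
_≀_ : Pred Perm p → (L : Preorder c ℓ₁ ℓ₂) → Preorder (p ⊔ c) c ℓ₂
X ≀ L = On.preorder {B = ∃ (X ∘ proj₁)} (labelled-preorder L) proj₁

-- The levels are those of the quasi-orders of labels.
LWQO : ∀ c ℓ₁ ℓ₂ → Pred Perm p → Set (p ⊔ lsuc (c ⊔ ℓ₁ ⊔ ℓ₂))
LWQO c ℓ₁ ℓ₂ X = (L : Preorder c ℓ₁ ℓ₂) → WQO L → WQO (X ≀ L)

{-# OPTIONS --safe #-}
module Submission where

-- Every member of the closure splits as a head from C followed by a tail that
-- again lies in the closure, with fewer summands.  Embeddings of head into head
-- and of tail into tail combine, so a minimal bad sequence is impossible by the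
-- argument of Nash-Williams for Higman's lemma: along a subsequence the heads
-- ascend, and replacing the terms there by their tails gives a smaller bad
-- sequence.  The sum and the skew sum differ only in whether the values of the
-- tail lie above or below those of the head.  Containment without labels is the
-- case of a one-element label set.

open import Axiom.DoubleNegationElimination using (em⇒dne)
open import Axiom.ExcludedMiddle using (ExcludedMiddle)
open import Data.Empty using (⊥-elim)
open import Data.Fin.Base using (Fin; toℕ; _↑ˡ_; _↑ʳ_; _<_; punchIn; punchOut; splitAt)
open import Data.Fin.Permutation using (Permutation′; _⟨$⟩ʳ_; punchIn-permute; remove) renaming (id to idₚ)
open import Data.Fin.Properties
  using (_≟_; any?; <-asym; <-cmp; <-irrefl; punchIn-mono-≤; punchIn-cancel-≤; punchIn-punchOut;
         splitAt⁻¹-↑ˡ; splitAt⁻¹-↑ʳ; toℕ-↑ˡ; toℕ-↑ʳ; toℕ<n)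
import Data.Nat.Base as ℕ
open import Data.Nat.Base using (ℕ; zero; suc; _∸_)
open import Data.Nat.Induction using (<-wellFounded)
import Data.Nat.Properties as ℕₚ
open import Data.Product.Base using (∃; ∃₂; _×_; _,_; proj₁; proj₂)
open import Data.Sum.Base using (_⊎_; inj₁; inj₂; [_,_]′)
open import Data.Unit.Base using (⊤)
open import Function.Base using (_∘_)
open import Function.Bundles using (_⇔_; mk⇔; Equivalence)
open import Function.Construct.Composition using (_⇔-∘_)
open import Function.Construct.Symmetry using (⇔-sym)
open import Induction.WellFounded using (Acc; acc)
open import Level using (Level; 0ℓ; _⊔_; Lift; lift; lower) renaming (suc to lsuc)
open import Relation.Binary.Bundles using (Preorder)
open import Relation.Binary.Core using (Rel)
open import Relation.Binary.Definitions using (Transitive; tri<; tri≈; tri>)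
open import Relation.Binary.PropositionalEquality
  using (_≡_; refl; sym; trans; cong; subst; subst₂; isEquivalence)
open import Relation.Nullary using (¬_; yes; no; contradiction)
open import Relation.Nullary.Decidable using (map′; decidable-stable)
open import Relation.Unary using (Pred; Decidable; _⊆_)
open import Relation.Unary.Properties using (∁?)
open import Defs

open Equivalence using (to; from)

private
  variable
    a p c ℓ ℓ₁ ℓ₂ : Level

em-lower : ∀ b → ExcludedMiddle (a ⊔ b) → ExcludedMiddle a
em-lower b em = map′ lower lift (em {P = Lift b _})

-- Sequences in quasi-orders

chain : ∀ {X : Set a} {R : Rel X ℓ} → Transitive R → (x : ℕ → X) →
        (∀ k → R (x k) (x (suc k))) → ∀ {i j} → i ℕ.< j → R (x i) (x j)
chain {R = R} R-trans x step {i} {suc j} i<1+j with ℕₚ.m<1+n⇒m<n∨m≡n i<1+j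
... | inj₁ i<j  = R-trans (chain {R = R} R-trans x step i<j) (step j)
... | inj₂ refl = step j

module _ (Y : Preorder c ℓ₁ ℓ₂) where
  open Preorder Y using (Carrier; _≲_) renaming (trans to ≲-trans)

  Bad : (ℕ → Carrier) → Set ℓ₂
  Bad y = ∀ {i j} → i ℕ.< j → ¬ y i ≲ y j

  ¬Bad⇒WQO : ExcludedMiddle (c ⊔ ℓ₂) → (∀ y → ¬ Bad y) → WQO Y
  ¬Bad⇒WQO em ¬bad y = em⇒dne (em-lower c em)
    λ ¬good → ¬bad y λ {i} {j} i<j i≲j → ¬good (i , j , i<j , i≲j)

  -- Call an index terminal if no later term lies above its term. Unboundedly many terminal indices
  -- would form a bad subsequence, so from some `N` on every index is dominated by a later one, and
  -- following these dominations from `N` gives `φ`.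
  ascending-subsequence : ExcludedMiddle (c ⊔ ℓ₂) → WQO Y → (y : ℕ → Carrier) →
    ∃ λ (φ : ℕ → ℕ) → ∀ {i j} → i ℕ.< j → (φ i ℕ.< φ j) × (y (φ i) ≲ y (φ j))
  ascending-subsequence em wqo y with bounded
    where
    dne = em⇒dne (em-lower c em)

    Dominated Terminal : ℕ → Set ℓ₂
    Dominated n = ∃ λ m → (n ℕ.< m) × (y n ≲ y m)
    Terminal n = ∀ m → n ℕ.< m → ¬ y n ≲ y m

    ¬unbounded : ¬ (∀ N → ∃ λ n → (N ℕ.≤ n) × Terminal n)
    ¬unbounded next = clash (wqo (y ∘ t))
      where
      t : ℕ → ℕ
      t zero    = proj₁ (next zero)
      t (suc k) = proj₁ (next (suc (t k)))

      terminal : ∀ k → Terminal (t k)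
      terminal zero    = proj₂ (proj₂ (next zero))
      terminal (suc k) = proj₂ (proj₂ (next (suc (t k))))

      clash : ¬ (∃₂ λ i j → (i ℕ.< j) × (y (t i) ≲ y (t j)))
      clash (i , j , i<j , ti≲tj) = terminal i (t j)
        (chain {R = ℕ._<_} ℕₚ.<-trans t (λ k → proj₁ (proj₂ (next (suc (t k))))) i<j) ti≲tj

    bounded : ∃ λ N → ∀ n → N ℕ.≤ n → Dominated n
    bounded = dne λ ¬b → ¬unbounded λ N → dne λ ¬t → ¬b
      (N , λ n N≤n → dne λ ¬d → ¬t (n , N≤n , λ m n<m n≲m → ¬d (m , n<m , n≲m)))
  ... | N , next = proj₁ ∘ ψ , chain {R = R} R-trans (proj₁ ∘ ψ) (λ k → proj₂ (next _ (proj₂ (ψ k))))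
    where
    ψ : ℕ → ∃ (N ℕ.≤_)
    ψ zero    = N , ℕₚ.≤-refl
    ψ (suc k) with n , N≤n ← ψ k with m , n<m , _ ← next n N≤n =
      m , ℕₚ.≤-trans N≤n (ℕₚ.<⇒≤ n<m)

    R : Rel ℕ ℓ₂
    R m n = (m ℕ.< n) × (y m ≲ y n)

    R-trans : Transitive R
    R-trans (m<n , m≲n) (n<o , n≲o) = ℕₚ.<-trans m<n n<o , ≲-trans m≲n n≲o

  -- Minimal bad sequences

  infix 4 _≡[<_]_
  _≡[<_]_ : (ℕ → Carrier) → ℕ → (ℕ → Carrier) → Set c
  f ≡[< n ] g = ∀ {i} → i ℕ.< n → f i ≡ g i

  module _ (em : ExcludedMiddle (c ⊔ ℓ₂)) (size : Carrier → ℕ) where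

    MinimalAt : ℕ → (ℕ → Carrier) → Set (c ⊔ ℓ₂)
    MinimalAt n f = ∀ g → Bad g → g ≡[< n ] f → size (f n) ℕ.≤ size (g n)

    -- Descent on the size of term `n`: either some bad sequence with the same first `n` terms has a
    -- smaller one, or `f` itself is minimal there.
    minimise : ∀ n f → Bad f → Acc ℕ._<_ (size (f n)) →
               ∃ λ g → Bad g × g ≡[< n ] f × MinimalAt n g
    minimise n f f-bad (acc rs)
      with em {P = ∃ λ g → Bad g × g ≡[< n ] f × (size (g n) ℕ.< size (f n))}
    ... | no ¬smaller = f , f-bad , (λ _ → refl) , λ g g-bad g≡f →
      ℕₚ.≮⇒≥ λ g<f → ¬smaller (g , g-bad , g≡f , g<f)
    ... | yes (g , g-bad , g≡f , g<f)
      with h , h-bad , h≡g , h-min ← minimise n g g-bad (rs g<f) =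
      h , h-bad , (λ i<n → trans (h≡g i<n) (g≡f i<n)) , h-min

    -- Stage `suc n` minimises term `n` and keeps the terms before it, so term `n` never changes
    -- afterwards. The diagonal of the stages is the limit.
    minimal-bad-sequence : ∀ f → Bad f → ∃ λ g → Bad g × (∀ n → MinimalAt n g)
    minimal-bad-sequence f f-bad = g , g-bad , g-min
      where
      stage : ℕ → ∃ λ h → Bad h
      step : ∀ n → ∃ λ h → Bad h × h ≡[< n ] proj₁ (stage n) × MinimalAt n h
      step n = minimise n (proj₁ (stage n)) (proj₂ (stage n)) (<-wellFounded _)
      stage zero    = f , f-bad
      stage (suc n) = proj₁ (step n) , proj₁ (proj₂ (step n))

      g : ℕ → Carrier
      g n = proj₁ (stage (suc n)) n

      stage≡g : ∀ n → proj₁ (stage n) ≡[< n ] g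
      stage≡g (suc n) i<1+n with ℕₚ.m<1+n⇒m<n∨m≡n i<1+n
      ... | inj₁ i<n  = trans (proj₁ (proj₂ (proj₂ (step n))) i<n) (stage≡g n i<n)
      ... | inj₂ refl = refl

      g-bad : Bad g
      -- Both terms already occur in stage `suc j`, which is bad.
      g-bad {i} {j} i<j gi≲gj = proj₂ (stage (suc j)) i<j
        (subst (_≲ g j) (sym (stage≡g (suc j) (ℕₚ.m<n⇒m<1+n i<j))) gi≲gj)

      g-min : ∀ n → MinimalAt n g
      g-min n h h-bad h≡g = proj₂ (proj₂ (proj₂ (step n))) h h-bad λ i<n →
        trans (h≡g i<n) (sym (stage≡g (suc n) (ℕₚ.m<n⇒m<1+n i<n)))

-- The Nash-Williams argument for head-tail decompositions

record HeadTail (A Y : Preorder c ℓ₁ ℓ₂) ℓ : Set (c ⊔ ℓ₂ ⊔ lsuc ℓ) where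
  private module A = Preorder A
  open Preorder Y using (Carrier; _≲_)
  field
    Cons         : A.Carrier → Carrier → Carrier → Set ℓ
    size         : Carrier → ℕ
    -- An element without a decomposition is least, hence cannot occur in a bad sequence.
    decompose    : ∀ y → (∀ z → y ≲ z) ⊎ ∃₂ λ h t → Cons h t y
    tail-smaller : ∀ {h t y} → Cons h t y → size t ℕ.< size y
    tail-≲       : ∀ {h t y} → Cons h t y → t ≲ y
    cons-mono    : ∀ {h h′ t t′ y y′} → Cons h t y → Cons h′ t′ y′ →
                   h A.≲ h′ → t ≲ t′ → y ≲ y′

module _ {A Y : Preorder c ℓ₁ ℓ₂} (em : ExcludedMiddle (c ⊔ ℓ₂)) (ht : HeadTail A Y ℓ) where
  private module A = Preorder A
  open Preorder Y using (Carrier; _≲_)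
  open HeadTail ht

  ¬minimal-bad : WQO A → ∀ w → Bad Y w → ¬ (∀ n → MinimalAt Y em size n w)
  ¬minimal-bad A-wqo w w-bad w-min = ℕₚ.<⇒≱ (tail-smaller (cons N)) (subst
      (λ y → size (w N) ℕ.≤ size y) vN≡tailN (w-min N v v-bad v≡w))
    where
    parts : ∀ n → ∃₂ λ h t → Cons h t (w n)
    parts n with decompose (w n)
    ... | inj₁ least = ⊥-elim (w-bad (ℕₚ.n<1+n n) (least _))
    ... | inj₂ p     = p

    head : ℕ → A.Carrier
    head n = proj₁ (parts n)

    tail : ℕ → Carrier
    tail n = proj₁ (proj₂ (parts n))

    cons : ∀ n → Cons (head n) (tail n) (w n)
    cons n = proj₂ (proj₂ (parts n))

    sub = ascending-subsequence A em A-wqo head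
    φ = proj₁ sub
    N = φ 0

    N≤φ : ∀ k → N ℕ.≤ φ k
    N≤φ zero    = ℕₚ.≤-refl
    N≤φ (suc k) = ℕₚ.<⇒≤ (proj₁ (proj₂ sub {0} {suc k} ℕ.z<s))

    v : ℕ → Carrier
    v i with i ℕₚ.<? N
    ... | yes _ = w i
    -- The shift by `N` puts `tail (φ 0)` at position `N`, where it undercuts `w N`.
    ... | no _  = tail (φ (i ∸ N))

    v≡w : _≡[<_]_ Y v N w
    v≡w {i} i<N with i ℕₚ.<? N
    ... | yes _  = refl
    ... | no i≮N = contradiction i<N i≮N

    vN≡tailN : v N ≡ tail N
    vN≡tailN with N ℕₚ.<? N
    ... | yes N<N = contradiction N<N (ℕₚ.<-irrefl refl)
    ... | no _    = cong (tail ∘ φ) (ℕₚ.n∸n≡0 N)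

    v-bad : Bad Y v
    v-bad {i} {j} i<j with i ℕₚ.<? N | j ℕₚ.<? N
    ... | yes _   | yes _   = w-bad i<j
    -- A tail lies below its whole term, so the comparison would already hold in `w`.
    ... | yes i<N | no _    = λ wi≲t → w-bad (ℕₚ.<-≤-trans i<N (N≤φ (j ∸ N)))
      (Preorder.trans Y wi≲t (tail-≲ (cons _)))
    ... | no i≮N  | yes j<N = contradiction (ℕₚ.<-trans i<j j<N) i≮N
    -- Heads ascend along `φ`, so a comparison of tails would yield one of whole terms.
    ... | no i≮N  | no _
      with φi<φj , hi≲hj ← proj₂ sub (ℕₚ.∸-monoˡ-< i<j (ℕₚ.≮⇒≥ i≮N)) =
      λ ti≲tj → w-bad φi<φj (cons-mono (cons _) (cons _) hi≲hj ti≲tj)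

  headTail-wqo : WQO A → WQO Y
  headTail-wqo A-wqo = ¬Bad⇒WQO Y em λ y y-bad →
    let w , w-bad , w-min = minimal-bad-sequence Y em size y y-bad
    in ¬minimal-bad A-wqo w w-bad w-min

-- Embeddings of permutations

private
  variable
    m n : ℕ
    ρ σ τ π α β α′ β′ π′ : Perm

index-cancel-< : (f : σ ≼ π) → ∀ {i j} → index f i < index f j → i < j
index-cancel-< f {i} {j} fi<fj with <-cmp i j
... | tri< i<j _ _  = i<j
... | tri≈ _ refl _ = contradiction fi<fj (<-irrefl refl)
... | tri> _ _ j<i  = contradiction fi<fj (<-asym (increasing f j<i))

Image : σ ≼ π → Pred (Fin (length π)) 0ℓ
Image f i = ∃ λ j → index f j ≡ i

image? : (f : σ ≼ π) → Decidable (Image f)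
image? f i = any? λ j → index f j ≟ i

-- Embeddings reflect as well as preserve the orders of positions and of values, so pulling the
-- points of `g` back along `f` gives an embedding.
factor : (g : ρ ≼ π) (f : σ ≼ π) → (∀ i → Image f (index g i)) → ρ ≼ σ
factor {ρ} {π} g f im = record
  { index      = proj₁ ∘ im
  ; increasing = λ {i} {j} i<j → index-cancel-< f
      (subst₂ _<_ (sym (proj₂ (im i))) (sym (proj₂ (im j))) (increasing g i<j))
  ; orderIso   = λ i j → ⇔-sym (orderIso f (proj₁ (im i)) (proj₁ (im j))) ⇔-∘
      subst₂ (λ x y → (ρ at i < ρ at j) ⇔ (π at x < π at y))
        (sym (proj₂ (im i))) (sym (proj₂ (im j))) (orderIso g i j)
  }

empty : Perm
empty = 0 , idₚ

empty-≼ : ¬ Fin (length σ) → σ ≼ π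
empty-≼ ¬i = record
  { index      = λ i → ⊥-elim (¬i i)
  ; increasing = λ {i} → ⊥-elim (¬i i)
  ; orderIso   = λ i → ⊥-elim (¬i i)
  }

punchIn-<-⇔ : ∀ (i : Fin (suc n)) j k → (j < k) ⇔ (punchIn i j < punchIn i k)
punchIn-<-⇔ i j k = mk⇔
  (λ j<k → ℕₚ.≰⇒> (ℕₚ.<⇒≱ j<k ∘ punchIn-cancel-≤ i k j))
  (λ ↑j<↑k → ℕₚ.≰⇒> (ℕₚ.<⇒≱ ↑j<↑k ∘ punchIn-mono-≤ i k j))

remove-≼ : ∀ (π : Permutation′ (suc n)) i → (n , remove i π) ≼ (suc n , π)
remove-≼ π i = record
  { index      = punchIn i
  ; increasing = λ {j} {k} → to (punchIn-<-⇔ i j k)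
  ; orderIso   = λ j k → subst₂ (λ x y → (remove i π ⟨$⟩ʳ j < remove i π ⟨$⟩ʳ k) ⇔ (x < y))
      (sym (punchIn-permute π i j)) (sym (punchIn-permute π i k))
      (punchIn-<-⇔ _ _ _)
  }

-- Positions outside `P` are deleted one at a time. What remains is the pattern of `π` on exactly
-- the positions in `P`.
restrict : ∀ n (π : Permutation′ n) {P : Pred (Fin n) ℓ} → Decidable P →
           ∃ λ ρ → ∃ λ (f : ρ ≼ (n , π)) → (∀ j → P (index f j)) × (P ⊆ Image f)
restrict zero π P? = (zero , π) , ≼-refl , (λ ()) , λ {i} _ → i , refl
restrict (suc n) π {P} P? with any? (∁? P?)
... | no ∄¬P = (suc n , π) , ≼-refl
  , (λ j → decidable-stable (P? j) λ ¬Pj → ∄¬P (j , ¬Pj)) , λ {i} _ → i , refl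
... | yes (i , ¬Pi)
  with ρ , f , f∈P , P⊆f ← restrict n (remove i π) (P? ∘ punchIn i) =
  ρ , ≼-trans f (remove-≼ π i) , f∈P , λ {j} Pj →
    let i≢j : ¬ i ≡ j
        i≢j = λ { refl → ¬Pi Pj }
        k , fk≡ = P⊆f (subst P (sym (punchIn-punchOut i≢j)) Pj)
    in k , trans (cong (punchIn i) fk≡) (punchIn-punchOut i≢j)

-- Splitting a permutation into two blocks

data Orientation : Set where
  sum skew : Orientation

Oriented : Orientation → Fin n → Fin n → Set
Oriented sum  x y = x < y
Oriented skew x y = y < x

-- The orientation settles both comparisons in each pair, so each equivalence joins two true or two
-- false statements.
oriented-⇔ : ∀ o {x y : Fin m} {x′ y′ : Fin n} → Oriented o x y → Oriented o x′ y′ →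
             ((x < y) ⇔ (x′ < y′)) × ((y < x) ⇔ (y′ < x′))
oriented-⇔ sum x<y x′<y′ = mk⇔ (λ _ → x′<y′) (λ _ → x<y)
  , mk⇔ (⊥-elim ∘ <-asym x<y) (⊥-elim ∘ <-asym x′<y′)
oriented-⇔ skew y<x y′<x′ = mk⇔ (⊥-elim ∘ <-asym y<x) (⊥-elim ∘ <-asym y′<x′)
  , mk⇔ (λ _ → y′<x′) (λ _ → y<x)

index-oriented : ∀ o (f : σ ≼ π) i j →
  Oriented o (σ at i) (σ at j) ⇔ Oriented o (π at index f i) (π at index f j)
index-oriented sum  f i j = orderIso f i j
index-oriented skew f i j = orderIso f j i

module Blocks (o : Orientation) where

  Before : (π : Perm) → Rel (Fin (length π)) 0ℓ
  Before π i j = (i < j) × Oriented o (π at i) (π at j)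

  index-before : (f : σ ≼ π) → ∀ {i j} → Before σ i j ⇔ Before π (index f i) (index f j)
  index-before f {i} {j} = mk⇔
    (λ (i<j , i∘j) → increasing f i<j , to (index-oriented o f i j) i∘j)
    (λ (i<j , i∘j) → index-cancel-< f i<j , from (index-oriented o f i j) i∘j)

  infix 4 _⊲_
  _⊲_ : α ≼ π → β ≼ π → Set
  _⊲_ {π = π} f g = ∀ i j → Before π (index f i) (index g j)

  -- A relational form of `π` being the sum or skew sum of `α` and `β`. Embeddings in place of an
  -- equation avoid casts between lengths and equality of pairs of a length and a permutation.
  -- Disjointness of the blocks follows from `left⊲right`.
  record Split (α β π : Perm) : Set where
    field
      left       : α ≼ π
      right      : β ≼ π
      left⊲right : left ⊲ right
      cover      : ∀ i → Image left i ⊎ Image right i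

  open Split

  -- Within a block, both orders are inherited from `f` or `g`. Across blocks they are forced on the
  -- two sides by `left⊲right` and `f⊲g`.
  copair : Split α β π → (f : α ≼ π′) (g : β ≼ π′) → f ⊲ g → π ≼ π′
  copair {α} {β} {π} {π′} s f g f⊲g = record
    { index = index′ ; increasing = increasing′ _ _ ; orderIso = orderIso′ }
    where
    index′ : Fin (length π) → Fin (length π′)
    index′ i = [ index f ∘ proj₁ , index g ∘ proj₁ ]′ (cover s i)

    increasing′ : ∀ i j → i < j → index′ i < index′ j
    increasing′ i j i<j with cover s i | cover s j
    ... | inj₁ (x , refl) | inj₁ (y , refl) = increasing f (index-cancel-< (left s) i<j)
    ... | inj₁ (x , refl) | inj₂ (y , refl) = proj₁ (f⊲g x y)
    ... | inj₂ (x , refl) | inj₁ (y , refl) = contradiction i<j (<-asym (proj₁ (left⊲right s y x)))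
    ... | inj₂ (x , refl) | inj₂ (y , refl) = increasing g (index-cancel-< (right s) i<j)

    orderIso′ : ∀ i j → (π at i < π at j) ⇔ (π′ at index′ i < π′ at index′ j)
    orderIso′ i j with cover s i | cover s j
    ... | inj₁ (x , refl) | inj₁ (y , refl) = orderIso f x y ⇔-∘ ⇔-sym (orderIso (left s) x y)
    ... | inj₁ (x , refl) | inj₂ (y , refl) =
      proj₁ (oriented-⇔ o (proj₂ (left⊲right s x y)) (proj₂ (f⊲g x y)))
    ... | inj₂ (x , refl) | inj₁ (y , refl) =
      proj₂ (oriented-⇔ o (proj₂ (left⊲right s y x)) (proj₂ (f⊲g y x)))
    ... | inj₂ (x , refl) | inj₂ (y , refl) = orderIso g x y ⇔-∘ ⇔-sym (orderIso (right s) x y)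

  split-mono : Split α β π → Split α′ β′ π′ → α ≼ α′ → β ≼ β′ → π ≼ π′
  split-mono s s′ f g = copair s (≼-trans f (left s′)) (≼-trans g (right s′))
    λ i j → left⊲right s′ (index f i) (index g j)

  split-empty : ∀ π → Split π empty π
  split-empty π = record
    { left = ≼-refl ; right = empty-≼ λ () ; left⊲right = λ _ () ; cover = λ i → inj₁ (i , refl) }

  -- The positions that `e` sends into the left block form `α′`, the others `β′`. By `cover` the
  -- latter land in the right block.
  split-pullback : σ ≼ π → Split α β π → ∃₂ λ α′ β′ → Split α′ β′ σ × α′ ≼ α × β′ ≼ β
  split-pullback {σ} {π} e s
    with α′ , f , f∈ , ⊆f ← restrict _ (proj₂ σ) (image? (left s) ∘ index e)
       | β′ , g , g∉ , ⊆g ← restrict _ (proj₂ σ) (∁? (image? (left s) ∘ index e)) = α′ , β′ , record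
    { left       = f
    ; right      = g
    ; left⊲right = λ i j → from (index-before e)
        (subst₂ (Before π) (proj₂ (f∈ i)) (proj₂ (g∈ j)) (left⊲right s _ _))
    ; cover      = cover′
    } , factor (≼-trans f e) (left s) f∈ , factor (≼-trans g e) (right s) g∈
    where
    g∈ : ∀ j → Image (right s) (index e (index g j))
    g∈ j with cover s (index e (index g j))
    ... | inj₁ ∈left  = contradiction ∈left (g∉ j)
    ... | inj₂ ∈right = ∈right

    cover′ : ∀ i → Image f i ⊎ Image g i
    cover′ i with image? (left s) (index e i)
    ... | yes ∈left = inj₁ (⊆f ∈left)
    ... | no ∉left  = inj₂ (⊆g ∉left)

  -- One half of associativity: `(α ∙ β) ∙ τ` embeds in `α ∙ (β ∙ τ)`.
  split-assoc-≼ : ∀ {π″} → Split α β σ → Split σ τ π → Split β τ ρ → Split α ρ π″ → π ≼ π″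
  split-assoc-≼ {σ = σ} {π″ = π″} s t u v = copair t e (≼-trans (right u) (right v)) e⊲
    where
    e : σ ≼ π″
    e = split-mono s v ≼-refl (left u)

    e⊲ : e ⊲ ≼-trans (right u) (right v)
    e⊲ i j with cover s i
    ... | inj₁ (x , _) = left⊲right v x (index (right u) j)
    ... | inj₂ (x , _) = to (index-before (right v)) (left⊲right u x j)

  -- Iterated sums over a class

  module Iterated (C : Pred Perm p) (C-closed : IsPermutationClass C)
    (_∙_ : Perm → Perm → Perm) (∙-split : ∀ σ τ → Split σ τ (σ ∙ τ)) where

    -- Lists of summands from `C`. Emptiness is stated as having no positions, a form that passes
    -- directly down an embedding.
    data Sum (π : Perm) : Set p where
      nil  : ¬ Fin (length π) → Sum π
      cons : C α → Sum β → Split α β π → Sum π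

    Sum-closed : IsPermutationClass Sum
    Sum-closed e (nil ¬i)        = nil (¬i ∘ index e)
    Sum-closed e (cons Cα Sβ s) with _ , _ , s′ , α′≼α , β′≼β ← split-pullback e s =
      cons (C-closed α′≼α Cα) (Sum-closed β′≼β Sβ) s′

    -- Concatenation of lists of summands. If `σ` is empty, the right block is everything; otherwise
    -- reassociation moves the first summand to the front, and downward closure turns the embedding
    -- into membership.
    Sum-∙ : Sum σ → Sum τ → Sum (σ ∙ τ)
    Sum-∙ {σ} {τ} (nil ¬i) Sτ = Sum-closed (factor ≼-refl (right s) ∈right) Sτ
      where
      s = ∙-split σ τ
      ∈right : ∀ i → Image (right s) i
      ∈right i with cover s i
      ... | inj₁ (j , _) = contradiction j ¬i
      ... | inj₂ j       = j
    Sum-∙ {σ} {τ} (cons {α} {β} Cα Sβ s) Sτ =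
      Sum-closed (split-assoc-≼ s (∙-split σ τ) (∙-split β τ) v) (cons Cα (Sum-∙ Sβ Sτ) v)
      where v = ∙-split α (β ∙ τ)

    ClosureUnder⊆Sum : ClosureUnder _∙_ C ⊆ Sum
    ClosureUnder⊆Sum = ClosureUnder-least Sum Sum-closed Sum-∙
      λ {π} Cπ → cons Cπ (nil λ ()) (split-empty π)

    -- Measures the list and not the length of `π`: a head may be empty, and then the tail is as
    -- long as the whole.
    summands : Sum π → ℕ
    summands (nil _)       = 0
    summands (cons _ Sβ _) = suc (summands Sβ)

    module _ (L : Preorder c ℓ₁ ℓ₂) where
      private
        module L = Preorder L
        module C≀L = Preorder (C ≀ L)
        module S≀L = Preorder (Sum ≀ L)

      record Cons (h : C≀L.Carrier) (t y : S≀L.Carrier) : Set c where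
        field
          split   : Split (proj₁ (proj₁ h)) (proj₁ (proj₁ t)) (proj₁ (proj₁ y))
          label-l : proj₂ (proj₁ h) ≡ proj₂ (proj₁ y) ∘ index (left split)
          label-r : proj₂ (proj₁ t) ≡ proj₂ (proj₁ y) ∘ index (right split)
          smaller : summands (proj₂ t) ℕ.< summands (proj₂ y)
      open Cons

      decompose : ∀ y → (∀ z → y S≀L.≲ z) ⊎ ∃₂ λ h t → Cons h t y
      decompose ((π , ℓπ) , nil ¬i) = inj₁ λ _ → empty-≼ ¬i , λ i → contradiction i ¬i
      decompose ((π , ℓπ) , cons Cα Sβ s) = inj₂
        ( ((_ , ℓπ ∘ index (left s)) , Cα) , ((_ , ℓπ ∘ index (right s)) , Sβ)
        , record { split = s ; label-l = refl ; label-r = refl ; smaller = ℕₚ.n<1+n _ } )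

      tail-≲ : ∀ {h t y} → Cons h t y → t S≀L.≲ y
      tail-≲ record { split = s ; label-r = refl } = right s , λ _ → L.refl

      cons-mono : ∀ {h h′ t t′ y y′} → Cons h t y → Cons h′ t′ y′ →
                  h C≀L.≲ h′ → t S≀L.≲ t′ → y S≀L.≲ y′
      cons-mono {y = (_ , ℓπ) , _} {y′ = (_ , ℓπ′) , _}
        record { split = s ; label-l = refl ; label-r = refl }
        record { split = s′ ; label-l = refl ; label-r = refl } (f , ℓf) (g , ℓg) =
        e , ℓe
        where
        e = split-mono s s′ f g
        ℓe : ∀ i → ℓπ i L.≲ ℓπ′ (index e i)
        -- `index e` is defined by the same case split, so each case reduces to the embedding of
        -- heads or of tails.
        ℓe i with cover s i
        ... | inj₁ (j , refl) = ℓf j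
        ... | inj₂ (j , refl) = ℓg j

      headTail : HeadTail (C ≀ L) (Sum ≀ L) c
      headTail = record
        { Cons         = Cons
        ; size         = summands ∘ proj₂
        ; decompose    = decompose
        ; tail-smaller = smaller
        ; tail-≲       = tail-≲
        ; cons-mono    = cons-mono
        }

      Sum-wqo : ExcludedMiddle (p ⊔ c ⊔ ℓ₂) → WQO (C ≀ L) → WQO (Sum ≀ L)
      Sum-wqo em = headTail-wqo em headTail

      ClosureUnder-wqo : ExcludedMiddle (p ⊔ c ⊔ ℓ₂) → WQO (C ≀ L) → WQO (ClosureUnder _∙_ C ≀ L)
      ClosureUnder-wqo em C-wqo y = Sum-wqo em C-wqo λ i →
        proj₁ (y i) , ClosureUnder⊆Sum (proj₂ (y i))

-- The two sums as splittings

open Blocks using (Split)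

shift-≼ : ∀ (h : Fin (length σ) → Fin (length π)) k v →
          (∀ i → toℕ (h i) ≡ k ℕ.+ toℕ i) →
          (∀ i → toℕ (π at h i) ≡ v ℕ.+ toℕ (σ at i)) → σ ≼ π
shift-≼ h k v pos val = record
  { index      = h
  ; increasing = λ {i} {j} → to (shift-<-⇔ k (pos i) (pos j))
  ; orderIso   = λ i j → shift-<-⇔ v (val i) (val j)
  }
  where
  shift-<-⇔ : ∀ d {x y x′ y′} → x′ ≡ d ℕ.+ x → y′ ≡ d ℕ.+ y → (x ℕ.< y) ⇔ (x′ ℕ.< y′)
  shift-<-⇔ d refl refl = mk⇔ (ℕₚ.+-monoʳ-< d) (ℕₚ.+-cancelˡ-< d _ _)

low<high : ∀ {x y} (i : Fin m) {k} → x ≡ toℕ i → y ≡ m ℕ.+ k → x ℕ.< y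
low<high i refl refl = ℕₚ.<-≤-trans (toℕ<n i) (ℕₚ.m≤m+n _ _)

↑-cover : ∀ m n (k : Fin (m ℕ.+ n)) → (∃ λ i → i ↑ˡ n ≡ k) ⊎ (∃ λ j → m ↑ʳ j ≡ k)
↑-cover m n k with splitAt m k in eq
... | inj₁ i = inj₁ (i , splitAt⁻¹-↑ˡ eq)
... | inj₂ j = inj₂ (j , splitAt⁻¹-↑ʳ eq)

⊕-split : ∀ σ τ → Split sum σ τ (σ ⊕ τ)
⊕-split (m , σ) (n , τ) = record
  { left       = shift-≼ (_↑ˡ n) 0 0 (λ i → toℕ-↑ˡ i n) (⊕-left σ τ)
  ; right      = shift-≼ (m ↑ʳ_) m m (toℕ-↑ʳ m) (⊕-right σ τ)
  ; left⊲right = λ i j → low<high i (toℕ-↑ˡ i n) (toℕ-↑ʳ m j)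
                       , low<high _ (⊕-left σ τ i) (⊕-right σ τ j)
  ; cover      = ↑-cover m n
  }

⊖-split : ∀ σ τ → Split skew σ τ (σ ⊖ τ)
⊖-split (m , σ) (n , τ) = record
  { left       = shift-≼ (_↑ˡ n) 0 n (λ i → toℕ-↑ˡ i n) (⊖-left σ τ)
  ; right      = shift-≼ (m ↑ʳ_) m 0 (toℕ-↑ʳ m) (⊖-right σ τ)
  ; left⊲right = λ i j → low<high i (toℕ-↑ˡ i n) (toℕ-↑ʳ m j)
                       -- The values of the second block lie below `n`; those of the first are
                       -- offset by `n`.
                       , low<high _ (⊖-right σ τ j) (⊖-left σ τ i)
  ; cover      = ↑-cover m n
  }

-- Containment without labels, and the closure theorem

trivial : Preorder 0ℓ 0ℓ 0ℓ
trivial = record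
  { Carrier    = ⊤
  ; _≈_        = _≡_
  ; _≲_        = λ _ _ → ⊤
  ; isPreorder = record { isEquivalence = isEquivalence ; reflexive = λ _ → _ ; trans = λ _ _ → _ }
  }

wqo⇒wqo-trivial : ∀ {X : Pred Perm p} → WQO (containment X) → WQO (X ≀ trivial)
wqo⇒wqo-trivial wqo y with i , j , i<j , e ← wqo (λ i → proj₁ (proj₁ (y i)) , proj₂ (y i)) =
  i , j , i<j , e , _

wqo-trivial⇒wqo : ∀ {X : Pred Perm p} → WQO (X ≀ trivial) → WQO (containment X)
wqo-trivial⇒wqo wqo y with i , j , i<j , e , _ ← wqo (λ i → (proj₁ (y i) , _) , proj₂ (y i)) =
  i , j , i<j , e

theorem6p2 : ∀ {p c ℓ₁ ℓ₂ : Level} → ExcludedMiddle (p ⊔ c ⊔ ℓ₁ ⊔ ℓ₂) →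
    (C : Pred Perm p) → IsPermutationClass C →
    (WQO (containment C) →
    WQO (containment (SumClosure C)) × WQO (containment (SkewClosure C))) ×
    (LWQO c ℓ₁ ℓ₂ C →
    LWQO c ℓ₁ ℓ₂ (SumClosure C) × LWQO c ℓ₁ ℓ₂ (SkewClosure C))
theorem6p2 {p} {c} {ℓ₁} {ℓ₂} em C C-closed =
    (λ C-wqo → wqo-trivial⇒wqo (Sums.ClosureUnder-wqo trivial em₀ (wqo⇒wqo-trivial C-wqo))
             , wqo-trivial⇒wqo (Skews.ClosureUnder-wqo trivial em₀ (wqo⇒wqo-trivial C-wqo)))
  -- The label order stays fixed throughout: the transfer from `C` to its closure is made for each
  -- `L` separately.
  , (λ C-lwqo → (λ L L-wqo → Sums.ClosureUnder-wqo L em₁ (C-lwqo L L-wqo))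
              , (λ L L-wqo → Skews.ClosureUnder-wqo L em₁ (C-lwqo L L-wqo)))
  where
  module Sums = Blocks.Iterated sum C C-closed _⊕_ ⊕-split
  module Skews = Blocks.Iterated skew C C-closed _⊖_ ⊖-split
  em₀ : ExcludedMiddle p
  em₀ = em-lower (c ⊔ ℓ₁ ⊔ ℓ₂) em
  em₁ : ExcludedMiddle (p ⊔ c ⊔ ℓ₂)
  em₁ = em-lower ℓ₁ em
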